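{- Let $k \geq 1$ and $n \geq 0$ be integers, and let $f_k(n)$ denote the number of abelian squares of length $2n$ over an alphabet with $k$ letters. Then $$ f_k(n) = \sum_{n_1 + \cdots + n_k = n} \left( \frac{n!}{n_1! \, n_2! \cdots n_k!} \right)^2, $$ where the sum is over all $k$-tuples $(n_1, \ldots, n_k)$ of non-negative integers with sum $n$.
   Context: An abelian square of length $2n$ is a string of the form $x x'$ where $|x| = |x'| = n$ and $x'$ is a permutation (rearrangement) of the symbols of $x$; equivalently, every letter of the alphabet occurs the same number of times in $x$ as in $x'$. The quantity $f_k(n)$ is the number of such strings over the alphabet $\{1, 2, \ldots, k\}$. By convention $f_k(0) = 1$ (the empty string is counted when $n = 0$). -}

module Defs where

open import Data.Fin.Base using (Fin)
import Data.Fin.Properties as Fin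
open import Data.List.Base as List using (List; []; _∷_; cartesianProductWith)
open import Data.List.Membership.Propositional.Properties using (∈-∃++)
open import Data.List.Relation.Binary.Permutation.Propositional
  using (_↭_; ↭-refl; ↭-sym; ↭-trans; prep)
open import Data.List.Relation.Binary.Permutation.Propositional.Properties
  using (shift; drop-∷; ∈-resp-↭; ¬x∷xs↭[])
open import Data.List.Relation.Unary.All using (universal)
import Data.List.Relation.Unary.All.Properties as All
open import Data.List.Relation.Unary.Any using (here)
open import Data.Nat.Base using (ℕ; zero; suc; _+_; _!; NonZero)
open import Data.Nat.DivMod using (_/_)
open import Data.Nat.ListAction using (product)
open import Data.Nat.ListAction.Properties using (product≢0)
open import Data.Nat.Properties using (_≟_; _!≢0)
open import Data.Product.Base using (_×_; _,_; ∃₂)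
open import Data.Vec.Base as Vec using (Vec; []; _∷_; _++_; toList)
open import Data.Vec.Properties using (++-injective)
open import Relation.Binary.Definitions using (Decidable; DecidableEquality)
open import Relation.Binary.PropositionalEquality using (_≡_; refl)
open import Relation.Nullary.Decidable using (Dec; yes; no; map′)

-- Every n-tuple with entries drawn from xs; each exactly once when xs has
-- no repetitions.
tuples : {A : Set} → List A → (n : ℕ) → List (Vec A n)
tuples xs zero    = [] ∷ []
tuples xs (suc n) = cartesianProductWith _∷_ xs (tuples xs n)

AbelianSquare : {A : Set} (n : ℕ) → Vec A (n + n) → Set
AbelianSquare {A} n w =
  ∃₂ λ (x x′ : Vec A n) → w ≡ x ++ x′ × toList x′ ↭ toList x

module _ {A : Set} (_≟ᴬ_ : DecidableEquality A) where

  open import Data.List.Membership.DecPropositional _≟ᴬ_ using (_∈?_)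

  ↭-dec : Decidable (_↭_ {A = A})
  ↭-dec []       []       = yes ↭-refl
  ↭-dec []       (y ∷ ys) = no λ p → ¬x∷xs↭[] (↭-sym p)
  ↭-dec (x ∷ xs) ys with x ∈? ys
  ... | no  x∉ys = no λ p → x∉ys (∈-resp-↭ p (here refl))
  ... | yes x∈ys with ∈-∃++ x∈ys
  ...   | ps , qs , refl = map′
    (λ p → ↭-trans (prep x p) (↭-sym (shift x ps qs)))
    (λ p → drop-∷ (↭-trans p (shift x ps qs)))
    (↭-dec xs (ps List.++ qs))

  abelianSquare? : (n : ℕ) (w : Vec A (n + n)) → Dec (AbelianSquare n w)
  abelianSquare? n w with Vec.splitAt n w
  ... | x , x′ , refl = map′
    (λ p → x , x′ , refl , p)
    (λ { (y , y′ , eq , p) → from y y′ (++-injective x y eq) p })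
    (↭-dec (toList x′) (toList x))
    where
    from : ∀ y y′ → x ≡ y × x′ ≡ y′ → toList y′ ↭ toList y → toList x′ ↭ toList x
    from y y′ (refl , refl) p = p

f : (k n : ℕ) → ℕ
f k n = List.length
  (List.filter (abelianSquare? Fin._≟_ n) (tuples (List.allFin k) (n + n)))

-- The k-tuples of natural numbers with sum n.  No entry of such a tuple
-- exceeds n, so it suffices to search among the entries 0, …, n.
tuplesWithSum : (k n : ℕ) → List (Vec ℕ k)
tuplesWithSum k n =
  List.filter (λ ns → Vec.sum ns ≟ n) (tuples (List.upTo (suc n)) k)

∏! : {k : ℕ} → Vec ℕ k → ℕ
∏! ns = product (List.map _! (toList ns))

∏!≢0 : {k : ℕ} (ns : Vec ℕ k) → NonZero (∏! ns)
∏!≢0 ns = product≢0 (All.map⁺ (universal _!≢0 (toList ns)))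

-- n! / (n₁! ⋯ nₖ!), by natural-number division, which is exact whenever
-- n₁ + ⋯ + nₖ = n.
multinomial : {k : ℕ} → ℕ → Vec ℕ k → ℕ
multinomial n ns = _/_ (n !) (∏! ns) ⦃ ∏!≢0 ns ⦄

{-# OPTIONS --safe #-}

-- Two words are rearrangements of each other iff they have the same Parikh
-- vector (the number of occurrences of each letter), so grouping the pairs
-- (x , x′) by their common Parikh vector ns shows that f k n is the sum of the
-- squares of N(ns), the number of words of length n with Parikh vector ns.
-- Splitting off the first letter i of such a word gives
-- N(ns) ∏ ns! = Σᵢ nsᵢ (n−1)! = n! by induction on n.

module Submission where

open import Defs
open import Algebra.Properties.CommutativeSemigroup using (interchange; x∙yz≈y∙xz)
open import Data.Bool.Base using (if_then_else_)
open import Data.Fin.Base using (Fin; zero; suc)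
import Data.Fin.Properties as Fin
open import Data.List.Base as List
  using (List; []; _∷_; _++_; map; filter; length; allFin; upTo; cartesianProductWith)
open import Data.List.Membership.Propositional using (_∈_)
open import Data.List.Membership.Propositional.Properties
  using (∈-∃++; ∈-cartesianProductWith⁺; ∈-upTo⁺)
open import Data.List.Properties using (map-++; map-∘; map-cong; map-tabulate)
open import Data.List.Relation.Binary.Permutation.Propositional
  using (_↭_; refl; prep; swap; trans; ↭-sym)
open import Data.List.Relation.Binary.Permutation.Propositional.Properties using (shift)
open import Data.List.Relation.Unary.All as All using (All; []; _∷_)
open import Data.List.Relation.Unary.Any using (here; there)
open import Data.List.Relation.Unary.Unique.Propositional using (Unique; []; _∷_)
open import Data.List.Relation.Unary.Unique.Propositional.Properties
  using (upTo⁺; cartesianProductWith⁺)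
open import Data.Nat.Base using (ℕ; zero; suc; _+_; _*_; _^_; _!; _≤_; s≤s)
open import Data.Nat.DivMod using (_/_; /-congˡ; m*n/n≡m)
open import Data.Nat.ListAction using (sum)
open import Data.Nat.ListAction.Properties using (sum-++)
open import Data.Nat.Properties
open import Data.Product.Base using (∃; _,_)
open import Data.Sum.Base using (_⊎_; inj₁; inj₂)
open import Data.Vec.Base as Vec using (Vec; []; _∷_; toList; lookup; replicate; _[_]%=_)
open import Data.Vec.Properties
  using (≡-dec; ∷-injective; ∷-injectiveˡ; ∷-injectiveʳ; ++-injective; lookup-replicate;
         lookup∘updateAt; lookup∘updateAt′; updateAt-commutes)
open import Function.Base using (_∘_)
open import Relation.Binary.PropositionalEquality
  using (_≡_; _≢_; refl; sym; cong; cong₂; module ≡-Reasoning)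
  renaming (trans to ≡-trans)
open import Relation.Nullary using (¬_; contradiction)
open import Relation.Nullary.Decidable using (Dec; yes; no; does)
open import Relation.Unary using (Decidable)
open ≡-Reasoning

private
  variable
    A B C : Set
    P Q : Set
    k n : ℕ

-- Finite sums and indicators

∑ : List A → (A → ℕ) → ℕ
∑ xs g = sum (map g xs)

syntax ∑ xs (λ x → e) = ∑[ x ← xs ] e

∑-cong : {g h : A → ℕ} → (∀ x → g x ≡ h x) → ∀ xs → ∑ xs g ≡ ∑ xs h
∑-cong g≗h xs = cong sum (map-cong g≗h xs)

∑-zero : (xs : List A) → ∑[ _ ← xs ] 0 ≡ 0
∑-zero []       = refl
∑-zero (_ ∷ xs) = ∑-zero xs

∑-+ : (xs : List A) (g h : A → ℕ) → ∑[ x ← xs ] (g x + h x) ≡ ∑ xs g + ∑ xs h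
∑-+ []       g h = refl
∑-+ (x ∷ xs) g h = begin
  g x + h x + ∑[ y ← xs ] (g y + h y)  ≡⟨ cong (g x + h x +_) (∑-+ xs g h) ⟩
  g x + h x + (∑ xs g + ∑ xs h)        ≡⟨ interchange +-commutativeSemigroup (g x) (h x) (∑ xs g) (∑ xs h) ⟩
  g x + ∑ xs g + (h x + ∑ xs h)        ∎

∑-*ʳ : (xs : List A) (g : A → ℕ) (c : ℕ) → ∑[ x ← xs ] (g x * c) ≡ ∑ xs g * c
∑-*ʳ []       g c = refl
∑-*ʳ (x ∷ xs) g c = begin
  g x * c + ∑[ y ← xs ] (g y * c)  ≡⟨ cong (g x * c +_) (∑-*ʳ xs g c) ⟩
  g x * c + ∑ xs g * c             ≡⟨ *-distribʳ-+ c (g x) (∑ xs g) ⟨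
  (g x + ∑ xs g) * c               ∎

∑-swap : (xs : List A) (ys : List B) (g : A → B → ℕ) →
         ∑[ x ← xs ] ∑[ y ← ys ] g x y ≡ ∑[ y ← ys ] ∑[ x ← xs ] g x y
∑-swap []       ys g = sym (∑-zero ys)
∑-swap (x ∷ xs) ys g = begin
  ∑ ys (g x) + ∑[ z ← xs ] ∑[ y ← ys ] g z y    ≡⟨ cong (∑ ys (g x) +_) (∑-swap xs ys g) ⟩
  ∑ ys (g x) + ∑[ y ← ys ] ∑[ z ← xs ] g z y    ≡⟨ ∑-+ ys (g x) _ ⟨
  ∑[ y ← ys ] (g x y + ∑[ z ← xs ] g z y)       ∎

∑-cartesianProductWith : (_∙_ : A → B → C) (xs : List A) (ys : List B) (g : C → ℕ) →
  ∑ (cartesianProductWith _∙_ xs ys) g ≡ ∑[ x ← xs ] ∑[ y ← ys ] g (x ∙ y)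
∑-cartesianProductWith _∙_ []       ys g = refl
∑-cartesianProductWith _∙_ (x ∷ xs) ys g = begin
  sum (map g (map (x ∙_) ys ++ xs∙ys))       ≡⟨ cong sum (map-++ g (map (x ∙_) ys) xs∙ys) ⟩
  sum (map g (map (x ∙_) ys) ++ map g xs∙ys) ≡⟨ sum-++ (map g (map (x ∙_) ys)) (map g xs∙ys) ⟩
  sum (map g (map (x ∙_) ys)) + ∑ xs∙ys g    ≡⟨ cong₂ _+_ (cong sum (sym (map-∘ ys)))
                                                         (∑-cartesianProductWith _∙_ xs ys g) ⟩
  ∑[ y ← ys ] g (x ∙ y) + ∑[ z ← xs ] ∑[ y ← ys ] g (z ∙ y) ∎
  where xs∙ys = cartesianProductWith _∙_ xs ys

∑-lookup : (ns : Vec ℕ k) → ∑[ i ← allFin k ] lookup ns i ≡ Vec.sum ns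
∑-lookup ns = ≡-trans (cong sum (map-tabulate (λ i → i) (lookup ns))) (sum-tabulate ns)
  where
  sum-tabulate : ∀ {k} (ns : Vec ℕ k) → sum (List.tabulate (lookup ns)) ≡ Vec.sum ns
  sum-tabulate []       = refl
  sum-tabulate (n ∷ ns) = cong (n +_) (sum-tabulate ns)

𝟙 : Dec P → ℕ
𝟙 p? = if does p? then 1 else 0

𝟙-no : (p? : Dec P) → ¬ P → 𝟙 p? ≡ 0
𝟙-no (yes p) ¬p = contradiction p ¬p
𝟙-no (no _)  ¬p = refl

𝟙-cong : (p? : Dec P) (q? : Dec Q) → (P → Q) → (Q → P) → 𝟙 p? ≡ 𝟙 q?
𝟙-cong (yes p) (yes q) to from = refl
𝟙-cong (yes p) (no ¬q) to from = contradiction (to p) ¬q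
𝟙-cong (no ¬p) (yes q) to from = contradiction (from q) ¬p
𝟙-cong (no ¬p) (no ¬q) to from = refl

length-filter : {R : A → Set} (R? : Decidable R) (xs : List A) →
                length (filter R? xs) ≡ ∑[ x ← xs ] 𝟙 (R? x)
length-filter R? []       = refl
length-filter R? (x ∷ xs) with R? x
... | yes _ = cong suc (length-filter R? xs)
... | no  _ = length-filter R? xs

-- Two summands are allowed because they need to agree only on `R`: the word count equals the
-- multinomial only for tuples of the right sum, and off `R` the count itself vanishes.
∑-filter : {R : A → Set} (R? : Decidable R) (g h : A → ℕ) →
           (∀ x → R x → g x ≡ h x) → (∀ x → ¬ R x → g x ≡ 0) →
           ∀ xs → ∑ xs g ≡ ∑ (filter R? xs) h
∑-filter R? g h g≡h g≡0 []       = refl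
∑-filter R? g h g≡h g≡0 (x ∷ xs) with R? x
... | yes r = cong₂ _+_ (g≡h x r) (∑-filter R? g h g≡h g≡0 xs)
... | no ¬r = cong₂ _+_ (g≡0 x ¬r) (∑-filter R? g h g≡h g≡0 xs)

-- The indicator acts as a Kronecker delta: membership makes it fire at least once, uniqueness at
-- most once.
∑-select : (_≟ᴬ_ : (x y : A) → Dec (x ≡ y)) {a : A} {xs : List A} (g : A → ℕ) →
           Unique xs → a ∈ xs → ∑[ x ← xs ] (𝟙 (a ≟ᴬ x) * g x) ≡ g a
∑-select {A} _≟ᴬ_ {a} g = select
  where
  vanish : ∀ {xs} → All (a ≢_) xs → ∑[ x ← xs ] (𝟙 (a ≟ᴬ x) * g x) ≡ 0
  vanish []                     = refl
  vanish {x ∷ _} (a≢x ∷ a≢xs) =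
    cong₂ _+_ (cong (_* g x) (𝟙-no (a ≟ᴬ x) a≢x)) (vanish a≢xs)

  select : ∀ {xs} → Unique xs → a ∈ xs → ∑[ x ← xs ] (𝟙 (a ≟ᴬ x) * g x) ≡ g a
  select (a≢xs ∷ _) (here refl) with a ≟ᴬ a
  ... | yes _   = ≡-trans (cong₂ _+_ (*-identityˡ (g a)) (vanish a≢xs)) (+-identityʳ (g a))
  ... | no  a≢a = contradiction refl a≢a
  select {x ∷ _} (x≢xs ∷ u) (there a∈xs) =
    cong₂ _+_ (cong (_* g x) (𝟙-no (a ≟ᴬ x) (λ { refl → All.lookup x≢xs a∈xs refl })))
              (select u a∈xs)

-- Tuples

∑-tuples-++ : (xs : List A) (m n : ℕ) (g : Vec A (m + n) → ℕ) →
  ∑ (tuples xs (m + n)) g ≡ ∑[ u ← tuples xs m ] ∑[ v ← tuples xs n ] g (u Vec.++ v)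
∑-tuples-++ xs zero    n g = sym (+-identityʳ _)
∑-tuples-++ xs (suc m) n g = begin
  ∑ (tuples xs (suc m + n)) g
    ≡⟨ ∑-cartesianProductWith _∷_ xs (tuples xs (m + n)) g ⟩
  ∑[ x ← xs ] ∑[ w ← tuples xs (m + n) ] g (x ∷ w)
    ≡⟨ ∑-cong (λ x → ∑-tuples-++ xs m n (g ∘ (x ∷_))) xs ⟩
  ∑[ x ← xs ] ∑[ u ← tuples xs m ] ∑[ v ← tuples xs n ] g (x ∷ u Vec.++ v)
    ≡⟨ ∑-cartesianProductWith _∷_ xs (tuples xs m) _ ⟨
  ∑[ u ← tuples xs (suc m) ] ∑[ v ← tuples xs n ] g (u Vec.++ v)
    ∎

tuples-unique : {xs : List A} → Unique xs → ∀ n → Unique (tuples xs n)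
tuples-unique u zero    = [] ∷ []
tuples-unique u (suc n) = cartesianProductWith⁺ _∷_ ∷-injective u (tuples-unique u n)

-- Each entry is bounded by the total. With `≤` in place of equality, the tail inherits the
-- hypothesis for the same `n`.
∈-tuples-upTo : (ns : Vec ℕ k) → Vec.sum ns ≤ n → ns ∈ tuples (upTo (suc n)) k
∈-tuples-upTo []       _   = here refl
∈-tuples-upTo (m ∷ ns) s≤n = ∈-cartesianProductWith⁺ _∷_
  (∈-upTo⁺ (s≤s (m+n≤o⇒m≤o m s≤n)))
  (∈-tuples-upTo ns (m+n≤o⇒n≤o m s≤n))

-- Incrementing an entry of a vector

sum-[]%=suc : (ns : Vec ℕ k) (i : Fin k) → Vec.sum (ns [ i ]%= suc) ≡ suc (Vec.sum ns)
sum-[]%=suc (n ∷ ns) zero    = refl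
sum-[]%=suc (n ∷ ns) (suc i) =
  ≡-trans (cong (n +_) (sum-[]%=suc ns i)) (+-suc n (Vec.sum ns))

∏!-[]%=suc : (ns : Vec ℕ k) (i : Fin k) → ∏! (ns [ i ]%= suc) ≡ suc (lookup ns i) * ∏! ns
∏!-[]%=suc (n ∷ ns) zero    = *-assoc (suc n) (n !) (∏! ns)
∏!-[]%=suc (n ∷ ns) (suc i) = begin
  n ! * ∏! (ns [ i ]%= suc)            ≡⟨ cong (n ! *_) (∏!-[]%=suc ns i) ⟩
  n ! * (suc (lookup ns i) * ∏! ns)    ≡⟨ x∙yz≈y∙xz *-commutativeSemigroup (n !) (suc (lookup ns i)) (∏! ns) ⟩
  suc (lookup ns i) * (n ! * ∏! ns)    ∎

[]%=suc-injective : (i : Fin k) {ms ns : Vec ℕ k} → ms [ i ]%= suc ≡ ns [ i ]%= suc → ms ≡ ns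
[]%=suc-injective zero    {m ∷ ms} {n ∷ ns} eq =
  cong₂ _∷_ (suc-injective (∷-injectiveˡ eq)) (∷-injectiveʳ eq)
[]%=suc-injective (suc i) {m ∷ ms} {n ∷ ns} eq =
  cong₂ _∷_ (∷-injectiveˡ eq) ([]%=suc-injective i (∷-injectiveʳ eq))

-- Decides whether a word with Parikh vector `ns` can begin with `i`; if so, `ms` is the Parikh
-- vector left for its tail, obtained without truncated subtraction.
zero-or-[]%=suc : (ns : Vec ℕ k) (i : Fin k) →
                  lookup ns i ≡ 0 ⊎ ∃ λ ms → ns ≡ ms [ i ]%= suc
zero-or-[]%=suc (zero  ∷ ns) zero = inj₁ refl
zero-or-[]%=suc (suc n ∷ ns) zero = inj₂ (n ∷ ns , refl)
zero-or-[]%=suc (n ∷ ns) (suc i) with zero-or-[]%=suc ns i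
... | inj₁ eq          = inj₁ eq
... | inj₂ (ms , refl) = inj₂ (n ∷ ms , refl)

sum≡0⇒≡replicate-0 : (ns : Vec ℕ k) → Vec.sum ns ≡ 0 → ns ≡ replicate k 0
sum≡0⇒≡replicate-0 []          _  = refl
sum≡0⇒≡replicate-0 (zero ∷ ns) eq = cong (0 ∷_) (sum≡0⇒≡replicate-0 ns eq)

-- Parikh vectors

parikh : List (Fin k) → Vec ℕ k
parikh []       = replicate _ 0
parikh (i ∷ is) = parikh is [ i ]%= suc

sum-parikh : (x : Vec (Fin k) n) → Vec.sum (parikh (toList x)) ≡ n
sum-parikh {k} []  = sum-zeros k
  where
  sum-zeros : ∀ k → Vec.sum (replicate k 0) ≡ 0
  sum-zeros zero    = refl
  sum-zeros (suc k) = sum-zeros k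
sum-parikh (i ∷ x) =
  ≡-trans (sum-[]%=suc (parikh (toList x)) i) (cong suc (sum-parikh x))

↭⇒parikh≡ : {is js : List (Fin k)} → is ↭ js → parikh is ≡ parikh js
↭⇒parikh≡ refl       = refl
↭⇒parikh≡ (prep i p) = cong (_[ i ]%= suc) (↭⇒parikh≡ p)
-- Increments at distinct positions commute; if `i` and `j` coincide, both sides increment the same
-- entry twice.
↭⇒parikh≡ (swap {ys = js} i j p) with i Fin.≟ j
... | yes refl = cong (λ ns → ns [ i ]%= suc [ i ]%= suc) (↭⇒parikh≡ p)
... | no  i≢j  =
  ≡-trans (cong (λ ns → ns [ j ]%= suc [ i ]%= suc) (↭⇒parikh≡ p))
          (updateAt-commutes i j i≢j (parikh js))
↭⇒parikh≡ (trans p q) = ≡-trans (↭⇒parikh≡ p) (↭⇒parikh≡ q)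

-- A head different from `i` leaves entry `i` untouched, so the positive count passes to the tail
-- until `i` is met.
lookup-parikh≡suc⇒∈ : (i : Fin k) (is : List (Fin k)) {m : ℕ} →
                      lookup (parikh is) i ≡ suc m → i ∈ is
lookup-parikh≡suc⇒∈ i []       eq with () ← ≡-trans (sym (lookup-replicate i 0)) eq
lookup-parikh≡suc⇒∈ i (j ∷ is) eq with i Fin.≟ j
... | yes i≡j = here i≡j
... | no  i≢j = there (lookup-parikh≡suc⇒∈ i is
  (≡-trans (sym (lookup∘updateAt′ i j i≢j (parikh is))) eq))

-- Induction on `is`: its head has a positive count in `js`, hence occurs there; `shift` brings it
-- to the front, and injectivity of the increment cancels it.
parikh≡⇒↭ : (is js : List (Fin k)) → parikh is ≡ parikh js → is ↭ js
parikh≡⇒↭ [] []       _  = refl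
parikh≡⇒↭ [] (j ∷ js) eq
  -- Equal counts would force `j` to occur in the empty list.
  with () ← lookup-parikh≡suc⇒∈ j []
              (≡-trans (cong (λ ns → lookup ns j) eq) (lookup∘updateAt j (parikh js)))
parikh≡⇒↭ (i ∷ is) js eq
  with ps , qs , refl ← ∈-∃++ (lookup-parikh≡suc⇒∈ i js
         (≡-trans (cong (λ ns → lookup ns i) (sym eq)) (lookup∘updateAt i (parikh is))))
  = trans (prep i (parikh≡⇒↭ is (ps ++ qs)
      ([]%=suc-injective i (≡-trans eq (↭⇒parikh≡ (shift i ps qs))))))
    (↭-sym (shift i ps qs))

-- Words with a given Parikh vector

words : (k n : ℕ) → List (Vec (Fin k) n)
words k = tuples (allFin k)

infix 4 _≟ⱽ_

_≟ⱽ_ : (ms ns : Vec ℕ k) → Dec (ms ≡ ns)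
_≟ⱽ_ = ≡-dec _≟_

-- This is N(ns). Being a sum of indicators rather than the length of a filtered list, it can be
-- exchanged with other sums.
#words : (n : ℕ) → Vec ℕ k → ℕ
#words {k} n ns = ∑[ x ← words k n ] 𝟙 (parikh (toList x) ≟ⱽ ns)

-- The entries of the Parikh vector of a word add up to its length.
#words≡0 : (ns : Vec ℕ k) → Vec.sum ns ≢ n → #words n ns ≡ 0
#words≡0 {k} {n} ns sum≢n = ≡-trans
  (∑-cong (λ x → 𝟙-no (parikh (toList x) ≟ⱽ ns)
    (λ eq → sum≢n (≡-trans (cong Vec.sum (sym eq)) (sum-parikh x)))) (words k n))
  (∑-zero (words k n))

-- The multiplied-out form keeps the induction free of division.
#words-∏! : (n : ℕ) (ns : Vec ℕ k) → Vec.sum ns ≡ n → #words n ns * ∏! ns ≡ n !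
#words-∏! {k} zero ns sum≡0 with refl ← sum≡0⇒≡replicate-0 ns sum≡0 = base k
  where
  ∏!-zeros : ∀ k → ∏! (replicate k 0) ≡ 1
  ∏!-zeros zero    = refl
  ∏!-zeros (suc k) = cong (_+ 0) (∏!-zeros k)

  base : ∀ k → #words 0 (replicate k 0) * ∏! (replicate k 0) ≡ 1
  -- The empty word is the only word of length 0, and its Parikh vector is zero.
  base k with replicate k 0 ≟ⱽ replicate k 0
  ... | yes _  = cong (_+ 0) (∏!-zeros k)
  ... | no  ¬p = contradiction refl ¬p
#words-∏! {k} (suc n) ns sum≡1+n = begin
  #words (suc n) ns * ∏! ns
    -- Words are grouped by first letter; `parikh` of `i ∷ x` unfolds to the increment in
    -- `startingWith`.
    ≡⟨ cong (_* ∏! ns) (∑-cartesianProductWith _∷_ (allFin k) (words k n) _) ⟩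
  ∑[ i ← allFin k ] startingWith i ns * ∏! ns
    ≡⟨ ∑-*ʳ (allFin k) (λ i → startingWith i ns) (∏! ns) ⟨
  ∑[ i ← allFin k ] (startingWith i ns * ∏! ns)
    ≡⟨ ∑-cong (λ i → step i ns sum≡1+n) (allFin k) ⟩
  ∑[ i ← allFin k ] (lookup ns i * n !)
    ≡⟨ ∑-*ʳ (allFin k) (lookup ns) (n !) ⟩
  ∑ (allFin k) (lookup ns) * n !
    ≡⟨ cong (_* n !) (≡-trans (∑-lookup ns) sum≡1+n) ⟩
  suc n * n !
    ∎
  where
  startingWith : Fin k → Vec ℕ k → ℕ
  startingWith i ns = ∑[ x ← words k n ] 𝟙 (parikh (toList x) [ i ]%= suc ≟ⱽ ns)

  step : ∀ i ns → Vec.sum ns ≡ suc n → startingWith i ns * ∏! ns ≡ lookup ns i * n !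
  step i ns sum≡1+n with zero-or-[]%=suc ns i
  -- A word beginning with `i` has a positive count of `i`, so both sides are 0.
  ... | inj₁ nsᵢ≡0 = begin
    startingWith i ns * ∏! ns  ≡⟨ cong (_* ∏! ns) (∑-cong none (words k n)) ⟩
    ∑[ _ ← words k n ] 0 * ∏! ns ≡⟨ cong (_* ∏! ns) (∑-zero (words k n)) ⟩
    0                          ≡⟨ cong (_* n !) nsᵢ≡0 ⟨
    lookup ns i * n !          ∎
    where
    none : ∀ x → 𝟙 (parikh (toList x) [ i ]%= suc ≟ⱽ ns) ≡ 0
    none x = 𝟙-no (parikh (toList x) [ i ]%= suc ≟ⱽ ns) λ eq → 1+n≢0 (begin
      suc (lookup (parikh (toList x)) i)           ≡⟨ lookup∘updateAt i (parikh (toList x)) ⟨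
      lookup (parikh (toList x) [ i ]%= suc) i     ≡⟨ cong (λ ms → lookup ms i) eq ⟩
      lookup ns i                                  ≡⟨ nsᵢ≡0 ⟩
      0                                            ∎)
  -- The tails are exactly the words with Parikh vector `ms`, and the factor by which `∏! ns′`
  -- exceeds `∏! ms` is entry `i` of `ns′`.
  ... | inj₂ (ms , refl) = begin
    startingWith i ns′ * ∏! ns′
      ≡⟨ cong₂ _*_ (∑-cong (λ x → 𝟙-cong (parikh (toList x) [ i ]%= suc ≟ⱽ ns′) (parikh (toList x) ≟ⱽ ms)
                             ([]%=suc-injective i) (cong (_[ i ]%= suc))) (words k n))
                   (∏!-[]%=suc ms i) ⟩
    #words n ms * (suc (lookup ms i) * ∏! ms)
      ≡⟨ x∙yz≈y∙xz *-commutativeSemigroup (#words n ms) (suc (lookup ms i)) (∏! ms) ⟩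
    suc (lookup ms i) * (#words n ms * ∏! ms)
      ≡⟨ cong₂ _*_ (sym (lookup∘updateAt i ms)) (#words-∏! n ms
           (suc-injective (≡-trans (sym (sum-[]%=suc ms i)) sum≡1+n))) ⟩
    lookup ns′ i * n !
      ∎
    where
    ns′ = ms [ i ]%= suc

-- By `#words-∏!` the division is exact, with the word count as quotient.
#words≡multinomial : (ns : Vec ℕ k) → Vec.sum ns ≡ n → #words n ns ≡ multinomial n ns
#words≡multinomial {n = n} ns sum≡n = sym (begin
  multinomial n ns
    ≡⟨ /-congˡ ⦃ ∏!≢0 ns ⦄ (sym (#words-∏! n ns sum≡n)) ⟩
  (#words n ns * ∏! ns / ∏! ns) ⦃ ∏!≢0 ns ⦄
    ≡⟨ m*n/n≡m (#words n ns) (∏! ns) ⦃ ∏!≢0 ns ⦄ ⟩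
  #words n ns
    ∎)

-- Counting abelian squares by Parikh vector

f≡∑#words : (k n : ℕ) → f k n ≡ ∑[ x ← words k n ] #words n (parikh (toList x))
f≡∑#words k n = begin
  f k n
    ≡⟨ length-filter square? (words k (n + n)) ⟩
  ∑[ w ← words k (n + n) ] 𝟙 (square? w)
    ≡⟨ ∑-tuples-++ (allFin k) n n (𝟙 ∘ square?) ⟩
  ∑[ x ← words k n ] ∑[ x′ ← words k n ] 𝟙 (square? (x Vec.++ x′))
    -- For a fixed first half `x`, the admissible second halves are the words sharing its Parikh
    -- vector.
    ≡⟨ ∑-cong (λ x → ∑-cong (λ x′ → 𝟙-cong (square? (x Vec.++ x′))
         (parikh (toList x′) ≟ⱽ parikh (toList x))
         (to x x′) (λ eq → x , x′ , refl , parikh≡⇒↭ _ _ eq)) (words k n)) (words k n) ⟩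
  ∑[ x ← words k n ] #words n (parikh (toList x))
    ∎
  where
  square? = abelianSquare? (Fin._≟_ {k}) n

  to : ∀ x x′ → AbelianSquare n (x Vec.++ x′) → parikh (toList x′) ≡ parikh (toList x)
  -- Both splittings cut the word at position `n`, so the halves `y`, `y′` are `x`, `x′`.
  to x x′ (y , y′ , eq , p) with refl , refl ← ++-injective x y eq = ↭⇒parikh≡ p

mainTheorem2 : (k n : ℕ) → 1 ≤ k →
    f k n ≡ sum (map (λ ns → multinomial n ns ^ 2) (tuplesWithSum k n))
mainTheorem2 k n _ = begin
  f k n
    ≡⟨ f≡∑#words k n ⟩
  ∑[ x ← words k n ] #words n (parikh (toList x))
    -- A delta over `T` names the Parikh vector of `x`; `T` contains it because its sum is `n`.
    ≡⟨ ∑-cong (λ x → ∑-select _≟ⱽ_ (#words n) (tuples-unique (upTo⁺ (suc n)) k)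
         (∈-tuples-upTo (parikh (toList x)) (≤-reflexive (sum-parikh x)))) (words k n) ⟨
  ∑[ x ← words k n ] ∑[ ns ← T ] (𝟙 (parikh (toList x) ≟ⱽ ns) * #words n ns)
    ≡⟨ ∑-swap (words k n) T _ ⟩
  ∑[ ns ← T ] ∑[ x ← words k n ] (𝟙 (parikh (toList x) ≟ⱽ ns) * #words n ns)
    -- With `ns` fixed, the second factor is constant in `x` and the indicators add up to
    -- `#words n ns` again, which yields the square.
    ≡⟨ ∑-cong (λ ns → ∑-*ʳ (words k n) _ (#words n ns)) T ⟩
  ∑[ ns ← T ] (#words n ns * #words n ns)
    -- `T` also holds tuples of the wrong sum; no word of length `n` has such a Parikh vector.
    ≡⟨ ∑-filter (λ ns → Vec.sum ns ≟ n) _ _ square vanish T ⟩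
  ∑[ ns ← tuplesWithSum k n ] (multinomial n ns ^ 2)
    ∎
  where
  T = tuples (upTo (suc n)) k

  square : ∀ ns → Vec.sum ns ≡ n → #words n ns * #words n ns ≡ multinomial n ns ^ 2
  square ns sum≡n rewrite #words≡multinomial ns sum≡n =
    cong (multinomial n ns *_) (sym (*-identityʳ (multinomial n ns)))

  vanish : ∀ ns → Vec.sum ns ≢ n → #words n ns * #words n ns ≡ 0
  vanish ns sum≢n = cong (λ m → m * m) (#words≡0 ns sum≢n)
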